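{- For all graphs $G$ and $H$: (i) $\max\{\gamma^{SLD}(G),\gamma^{SLD}(H)\}\le\gamma^{SLD}(G\,\square\, H)\le\min\{|V(H)|\,\gamma^{SLD}(G),\ |V(G)|\,\gamma^{SLD}(H)\}$; (ii) $\max\{\gamma^{DLD}(G),\gamma^{DLD}(H)\}\le\gamma^{DLD}(G\,\square\, H)\le\min\{|V(H)|\,\gamma^{DLD}(G),\ |V(G)|\,\gamma^{DLD}(H)\}$.
   Context: All graphs are finite, simple and undirected (not necessarily connected). For a vertex $u$, $N(u)$ is its set of neighbours and $N[u]=N(u)\cup\{u\}$. A code is a non-empty subset $C$ of the vertex set $V$; $I(C;u)=N[u]\cap C$. A code $C$ is self-locating-dominating if for every $u\in V\setminus C$ we have $I(C;u)\neq\emptyset$ and $\bigcap_{c\in I(C;u)}N[c]=\{u\}$. A code $C$ is solid-locating-dominating if $I(C;u)\ne\emptyset$ for every $u\in V\setminus C$ and $I(C;u)\not\subseteq I(C;v)$ for all distinct $u,v\in V\setminus C$. $\gamma^{SLD}$ and $\gamma^{DLD}$ denote the minimum sizes of such codes. The Cartesian product $G\square H$ has vertex set $V(G)\times V(H)$, with $(u,v)$ adjacent to $(u',v')$ iff either $u=u'$ and $vv'\in E(H)$, or $uu'\in E(G)$ and $v=v'$. -}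

module Defs where

open import Data.Fin.Base as Fin using (Fin)
import Data.Fin.Properties as Fin
open import Data.Fin.Subset as Subset using (Subset; Nonempty; ∣_∣)
import Data.Fin.Subset.Properties as Subset
open import Data.Nat.Base using (ℕ; zero; suc; _*_; _≤_; z≤n; s≤s; NonZero)
open import Data.Nat.Properties using (m*n≢0; _≟_)
open import Data.Product.Base using (∃; _×_; _,_; proj₁; proj₂)
open import Data.Product.Function.NonDependent.Propositional using (_×-↔_)
open import Data.Sum.Base using (_⊎_; inj₁; inj₂)
open import Function.Base using (_∘_)
open import Function.Bundles using (_↔_; Inverse)
open import Function.Construct.Composition using (_↔-∘_)
open import Function.Construct.Symmetry using (↔-sym)
open import Function.Properties.Inverse using (↔⇒↣)
open import Level using (0ℓ)
open import Relation.Binary.Core using (Rel)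
open import Relation.Binary.Definitions using (Symmetric; Irreflexive; DecidableEquality)
  renaming (Decidable to Decidable₂)
open import Relation.Binary.PropositionalEquality
open import Relation.Nullary
open import Relation.Nullary.Decidable using (map′; via-injection; ¬?; _×-dec_; _⊎-dec_; _→-dec_)
open import Relation.Unary

-- Graphs have at least one vertex: codes are non-empty, so a graph without
-- vertices has no code and γˢˡᵈ, γᵈˡᵈ would be undefined for it.
-- Decidable adjacency is no restriction classically.
record Graph : Set₁ where
  infix 4 _~_ _~?_
  field
    V        : Set
    order    : ℕ
    .{{order≢0}} : NonZero order
    enum     : V ↔ Fin order
    _~_      : Rel V 0ℓ
    _~?_     : Decidable₂ _~_
    ~-sym    : Symmetric _~_
    ~-irrefl : Irreflexive _≡_ _~_

  index : V → Fin order
  index = Inverse.to enum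

  vertex : Fin order → V
  vertex = Inverse.from enum

  _≟ⱽ_ : DecidableEquality V
  _≟ⱽ_ = via-injection (↔⇒↣ enum) Fin._≟_

  N N[_] : V → Pred V 0ℓ
  N u    = u ~_
  N[ u ] = N u ∪ ｛ u ｝

open Graph using (V; order)

infixr 7 _□_

_□_ : Graph → Graph → Graph
G □ H = record
  { V        = G.V × H.V
  ; order    = G.order * H.order
  ; order≢0  = m*n≢0 G.order H.order
  ; enum     = ↔-sym Fin.*↔× ↔-∘ (G.enum ×-↔ H.enum)
  ; _~_      = λ (u , v) (u′ , v′) → (u ≡ u′ × v H.~ v′) ⊎ (u G.~ u′ × v ≡ v′)
  ; _~?_     = λ (u , v) (u′ , v′) →
                 (u G.≟ⱽ u′ ×-dec v H.~? v′) ⊎-dec (u G.~? u′ ×-dec v H.≟ⱽ v′)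
  ; ~-sym    = λ { (inj₁ (p , q)) → inj₁ (sym p , H.~-sym q)
                 ; (inj₂ (p , q)) → inj₂ (G.~-sym p , sym q) }
  ; ~-irrefl = λ { refl (inj₁ (_ , q)) → H.~-irrefl refl q
                 ; refl (inj₂ (p , _)) → G.~-irrefl refl p }
  }
  where
  module G = Graph G
  module H = Graph H

module _ (G : Graph) where
  open Graph G hiding (V; order)

  -- The library's finite subsets live on Fin n, so a set of vertices is
  -- stored as the set of its indices.
  VertexSet : Set
  VertexSet = Subset (order G)

  ⟦_⟧ : VertexSet → Pred (V G) 0ℓ
  ⟦ C ⟧ u = index u Subset.∈ C

  I : VertexSet → V G → Pred (V G) 0ℓ
  I C u = N[ u ] ∩ ⟦ C ⟧

  IsCode : Pred VertexSet 0ℓ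
  IsCode = Nonempty

  SelfLocatingDominating : Pred VertexSet 0ℓ
  SelfLocatingDominating C =
    IsCode C ×
    (∀ u → u ∉ ⟦ C ⟧ →
      Satisfiable (I C u) × ⋂ (∃ (I C u)) (N[_] ∘ proj₁) ≐ ｛ u ｝)

  SolidLocatingDominating : Pred VertexSet 0ℓ
  SolidLocatingDominating C =
    IsCode C ×
    (∀ u → u ∉ ⟦ C ⟧ → Satisfiable (I C u)) ×
    (∀ u v → u ∉ ⟦ C ⟧ → v ∉ ⟦ C ⟧ → u ≢ v → I C u ⊈ I C v)

  IsMinimumSize : Pred VertexSet 0ℓ → ℕ → Set
  IsMinimumSize P k = (∃ λ C → P C × ∣ C ∣ ≡ k) × (∀ C → P C → k ≤ ∣ C ∣)

least : {P : Pred ℕ 0ℓ} → Decidable P → ∀ n → P n →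
        ∃ λ k → P k × (∀ j → P j → k ≤ j)
least P? zero    p = zero , p , λ _ _ → z≤n
least P? (suc n) p with P? zero
... | yes p₀ = zero , p₀ , λ _ _ → z≤n
... | no ¬p₀ with least (P? ∘ suc) n p
...   | k , q , min = suc k , q , λ { zero p₀ → contradiction p₀ ¬p₀
                                    ; (suc j) r → s≤s (min j r) }

module _ (G : Graph) where
  open Graph G hiding (V; order)

  minimumSize : {P : Pred (VertexSet G) 0ℓ} → Decidable P → ∃ P →
                ∃ (IsMinimumSize G P)
  minimumSize P? (C , p)
    with least (λ k → Subset.anySubset? λ D → P? D ×-dec (∣ D ∣ ≟ k)) ∣ C ∣ (C , p , refl)
  ... | k , attained , min = k , attained , λ D q → min ∣ D ∣ (D , q , refl)

  all? : {P : Pred (V G) 0ℓ} → Decidable P → Dec (∀ v → P v)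
  all? {P} P? = map′
    (λ f v → subst P (Inverse.strictlyInverseʳ enum v) (f (index v)))
    (λ f i → f (vertex i))
    (Fin.all? (P? ∘ vertex))

  satisfiable? : {P : Pred (V G) 0ℓ} → Decidable P → Dec (Satisfiable P)
  satisfiable? {P} P? = map′
    (λ (i , p) → vertex i , p)
    (λ (v , p) → index v , subst P (sym (Inverse.strictlyInverseʳ enum v)) p)
    (Fin.any? (P? ∘ vertex))

  ⊆? : {P Q : Pred (V G) 0ℓ} → Decidable P → Decidable Q → Dec (P ⊆ Q)
  ⊆? P? Q? = map′ (λ f {v} → f v) (λ f v → f {v}) (all? λ v → P? v →-dec Q? v)

  N[_]? : ∀ u → Decidable N[ u ]
  N[ u ]? v = (u ~? v) ⊎-dec (u ≟ⱽ v)

  ∉? : ∀ C → Decidable (_∉ ⟦_⟧ G C)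
  ∉? C u = ¬? (index u Subset.∈? C)

  I? : ∀ C u → Decidable (I G C u)
  I? C u v = N[ u ]? v ×-dec (index v Subset.∈? C)

  selfLocatingDominating? : Decidable (SelfLocatingDominating G)
  selfLocatingDominating? C =
    Subset.nonempty? C ×-dec
    all? λ u → ∉? C u →-dec
      (satisfiable? (I? C u) ×-dec (⊆? (⋂? u) (u ≟ⱽ_) ×-dec ⊆? (u ≟ⱽ_) (⋂? u)))
    where
    ⋂? : ∀ u → Decidable (⋂ (∃ (I G C u)) (N[_] ∘ proj₁))
    ⋂? u v = map′ (λ f (c , p) → f c p) (λ f c p → f (c , p))
                  (all? λ c → I? C u c →-dec N[ c ]? v)

  solidLocatingDominating? : Decidable (SolidLocatingDominating G)
  solidLocatingDominating? C =
    Subset.nonempty? C ×-dec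
    ((all? λ u → ∉? C u →-dec satisfiable? (I? C u)) ×-dec
     (all? λ u → all? λ v → ∉? C u →-dec (∉? C v →-dec
        (¬? (u ≟ⱽ v) →-dec ¬? (⊆? (I? C u) (I? C v))))))

  V-isCode : IsCode G Subset.⊤
  V-isCode = nonempty (order G)
    where
    nonempty : ∀ n → .{{NonZero n}} → Nonempty (Subset.⊤ {n})
    nonempty (suc n) = Fin.zero , Subset.∈⊤

  selfMinimum : ∃ (IsMinimumSize G (SelfLocatingDominating G))
  selfMinimum = minimumSize selfLocatingDominating?
    (Subset.⊤ , V-isCode , λ u u∉ → contradiction Subset.∈⊤ u∉)

  solidMinimum : ∃ (IsMinimumSize G (SolidLocatingDominating G))
  solidMinimum = minimumSize solidLocatingDominating?
    ( Subset.⊤ , V-isCode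
    , (λ u u∉ → contradiction Subset.∈⊤ u∉)
    , (λ u v u∉ → contradiction Subset.∈⊤ u∉) )

  γˢˡᵈ γᵈˡᵈ : ℕ
  γˢˡᵈ = proj₁ selfMinimum
  γᵈˡᵈ = proj₁ solidMinimum

  γˢˡᵈ-isMinimum : IsMinimumSize G (SelfLocatingDominating G) γˢˡᵈ
  γˢˡᵈ-isMinimum = proj₂ selfMinimum

  γᵈˡᵈ-isMinimum : IsMinimumSize G (SolidLocatingDominating G) γᵈˡᵈ
  γᵈˡᵈ-isMinimum = proj₂ solidMinimum

{-# OPTIONS --safe #-}
-- Projecting a code of G □ H to G gives a code of G: if u is outside the
-- projection, then the whole fibre over u is outside the code, so the code
-- vertices seen from (u , v) all lie in the copy G × {v}.
-- Conversely a code C of G lifts to C × V(H).  Two vertices in the same copy of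
-- G are separated as in G, and a vertex (w , x) with w outside C and x ≢ v is
-- not adjacent to any (c , v) with c in C, since adjacency would force c ≡ w.
-- The bounds in terms of H follow from G □ H ≅ H □ G.
module Submission where

open import Defs
open import Data.Nat.Base using (_*_; _⊔_; _⊓_; _≤_)
open import Data.Product.Base using (_×_)
open import Data.Fin.Base as Fin using (Fin)
open import Data.Fin.Subset as Subset using (Subset; inside; outside; ∣_∣)
import Data.Fin.Subset.Properties as Subset
open import Data.List.Base as List
  using (List; []; _∷_; length; map; cartesianProduct)
open import Data.List.Membership.Propositional using ()
  renaming (_∈_ to _∈ˡ_)
open import Data.List.Membership.Propositional.Properties
  using (∈-map⁺; ∈-map⁻; ∈-cartesianProduct⁺; ∈-cartesianProduct⁻)
open import Data.List.Properties using (length-map; length-++)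
open import Data.List.Relation.Unary.Any using (here; there)
open import Data.Nat.Base using (ℕ; suc; _+_; z≤n; s≤s)
open import Data.Nat.Properties
  using (+-suc; ≤-trans; ≤-reflexive; m≤n⇒m≤1+n; *-comm; ⊔-lub; ⊓-glb;
         module ≤-Reasoning)
open import Data.Product.Base using (∃; _,_; proj₁; proj₂; swap)
open import Data.Product.Algebra using (×-comm)
open import Data.Sum.Base as Sum using (inj₁; inj₂)
open import Data.Vec.Base using ([]; _∷_; here; there)
open import Function.Base using (_∘_; id)
open import Function.Bundles using (_↔_; Inverse)
open import Level using (0ℓ)
open import Relation.Binary.PropositionalEquality
open import Relation.Nullary
open import Relation.Unary using (Pred; Satisfiable; _⊆_; _∉_)

open Graph using (V; order; index; vertex; N[_])

-- Sizes of finite subsets and their lists of elements.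

∣p∪q∣≤∣p∣+∣q∣ : ∀ {n} (p q : Subset n) → ∣ p Subset.∪ q ∣ ≤ ∣ p ∣ + ∣ q ∣
∣p∪q∣≤∣p∣+∣q∣ []            []            = z≤n
∣p∪q∣≤∣p∣+∣q∣ (outside ∷ p) (outside ∷ q) = ∣p∪q∣≤∣p∣+∣q∣ p q
∣p∪q∣≤∣p∣+∣q∣ (outside ∷ p) (inside  ∷ q) =
  ≤-trans (s≤s (∣p∪q∣≤∣p∣+∣q∣ p q)) (≤-reflexive (sym (+-suc ∣ p ∣ ∣ q ∣)))
∣p∪q∣≤∣p∣+∣q∣ (inside  ∷ p) (outside ∷ q) = s≤s (∣p∪q∣≤∣p∣+∣q∣ p q)
∣p∪q∣≤∣p∣+∣q∣ (inside  ∷ p) (inside  ∷ q) =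
  s≤s (≤-trans (m≤n⇒m≤1+n (∣p∪q∣≤∣p∣+∣q∣ p q)) (≤-reflexive (sym (+-suc ∣ p ∣ ∣ q ∣))))

length-cartesianProduct : ∀ {A B : Set} (xs : List A) (ys : List B) →
  length (cartesianProduct xs ys) ≡ length xs * length ys
length-cartesianProduct []       ys = refl
length-cartesianProduct (x ∷ xs) ys =
  trans (length-++ (map (x ,_) ys))
        (cong₂ _+_ (length-map (x ,_) ys) (length-cartesianProduct xs ys))

elements : ∀ {n} → Subset n → List (Fin n)
elements []            = []
elements (outside ∷ p) = map Fin.suc (elements p)
elements (inside  ∷ p) = Fin.zero ∷ map Fin.suc (elements p)

length-elements : ∀ {n} (p : Subset n) → length (elements p) ≡ ∣ p ∣
length-elements []            = refl
length-elements (outside ∷ p) = trans (length-map Fin.suc (elements p)) (length-elements p)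
length-elements (inside  ∷ p) =
  cong suc (trans (length-map Fin.suc (elements p)) (length-elements p))

∈-elements⁺ : ∀ {n x} (p : Subset n) → x Subset.∈ p → x ∈ˡ elements p
∈-elements⁺ (inside  ∷ p) here        = here refl
∈-elements⁺ (inside  ∷ p) (there x∈p) = there (∈-map⁺ Fin.suc (∈-elements⁺ p x∈p))
∈-elements⁺ (outside ∷ p) (there x∈p) = ∈-map⁺ Fin.suc (∈-elements⁺ p x∈p)

∈-elements⁻ : ∀ {n x} (p : Subset n) → x ∈ˡ elements p → x Subset.∈ p
∈-elements⁻ (inside  ∷ p) (here refl) = here
∈-elements⁻ (inside  ∷ p) (there x∈)
  with _ , y∈ , refl ← ∈-map⁻ Fin.suc x∈ = there (∈-elements⁻ p y∈)
∈-elements⁻ (outside ∷ p) x∈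
  with _ , y∈ , refl ← ∈-map⁻ Fin.suc x∈ = there (∈-elements⁻ p y∈)

-- Vertex sets as lists of vertices.

module _ (G : Graph) where
  private module G = Graph G

  index-injective : ∀ {u v} → index G u ≡ index G v → u ≡ v
  index-injective {u} {v} eq =
    trans (sym (Inverse.strictlyInverseʳ G.enum u))
          (trans (cong (vertex G) eq) (Inverse.strictlyInverseʳ G.enum v))

  ∈-vertex⁺ : ∀ (C : VertexSet G) {i} → i Subset.∈ C → ⟦_⟧ G C (vertex G i)
  ∈-vertex⁺ C = subst (Subset._∈ C) (sym (Inverse.strictlyInverseˡ G.enum _))

  vertices : VertexSet G → List (V G)
  vertices C = map (vertex G) (elements C)

  length-vertices : ∀ C → length (vertices C) ≡ ∣ C ∣
  length-vertices C = trans (length-map (vertex G) (elements C)) (length-elements C)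

  ∈-vertices⁺ : ∀ C {u} → ⟦_⟧ G C u → u ∈ˡ vertices C
  ∈-vertices⁺ C {u} u∈C = subst (_∈ˡ vertices C) (Inverse.strictlyInverseʳ G.enum u)
    (∈-map⁺ (vertex G) (∈-elements⁺ C u∈C))

  ∈-vertices⁻ : ∀ C {u} → u ∈ˡ vertices C → ⟦_⟧ G C u
  ∈-vertices⁻ C u∈ with i , i∈ , refl ← ∈-map⁻ (vertex G) u∈ =
    ∈-vertex⁺ C (∈-elements⁻ C i∈)

  -- Repetitions in the list collapse, so the length bounds the size from above. That is the
  -- direction needed to bound a minimum by exhibiting a code.
  fromList : List (V G) → VertexSet G
  fromList = List.foldr (λ v C → Subset.⁅ index G v ⁆ Subset.∪ C) Subset.⊥

  ∣fromList∣≤length : ∀ vs → ∣ fromList vs ∣ ≤ length vs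
  ∣fromList∣≤length []       = ≤-reflexive (Subset.∣⊥∣≡0 (order G))
  ∣fromList∣≤length (v ∷ vs) = begin
    ∣ Subset.⁅ index G v ⁆ Subset.∪ fromList vs ∣    ≤⟨ ∣p∪q∣≤∣p∣+∣q∣ Subset.⁅ index G v ⁆ (fromList vs) ⟩
    ∣ Subset.⁅ index G v ⁆ ∣ + ∣ fromList vs ∣       ≡⟨ cong (_+ ∣ fromList vs ∣) (Subset.∣⁅x⁆∣≡1 (index G v)) ⟩
    suc ∣ fromList vs ∣                              ≤⟨ s≤s (∣fromList∣≤length vs) ⟩
    suc (length vs)                                  ∎
    where open ≤-Reasoning

  ∈-fromList⁺ : ∀ {u vs} → u ∈ˡ vs → ⟦_⟧ G (fromList vs) u
  ∈-fromList⁺ (here refl) = Subset.x∈p∪q⁺ (inj₁ (Subset.x∈⁅x⁆ _))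
  ∈-fromList⁺ (there u∈)  = Subset.x∈p∪q⁺ (inj₂ (∈-fromList⁺ u∈))

  ∈-fromList⁻ : ∀ {u} vs → ⟦_⟧ G (fromList vs) u → u ∈ˡ vs
  ∈-fromList⁻ []       u∈ = contradiction u∈ Subset.∉⊥
  ∈-fromList⁻ (v ∷ vs) u∈ with Subset.x∈p∪q⁻ _ (fromList vs) u∈
  ... | inj₁ u∈⁅v⁆ = here (index-injective (Subset.x∈⁅y⁆⇒x≡y _ u∈⁅v⁆))
  ... | inj₂ u∈vs  = there (∈-fromList⁻ vs u∈vs)

  isCode⁺ : ∀ C → Satisfiable (⟦_⟧ G C) → IsCode G C
  isCode⁺ C (u , u∈C) = index G u , u∈C

  isCode⁻ : ∀ C → IsCode G C → Satisfiable (⟦_⟧ G C)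
  isCode⁻ C (i , i∈C) = vertex G i , ∈-vertex⁺ C i∈C

  -- Exists because the order is non-zero. It selects the copy of `G` inside `G □ H` in which a
  -- projected code is tested.
  aVertex : V G
  aVertex = proj₁ (isCode⁻ Subset.⊤ (V-isCode G))

  N[]-sym : ∀ {u v} → N[_] G u v → N[_] G v u
  N[]-sym = Sum.map G.~-sym sym

-- Images of vertex sets under vertex maps.

module _ (G H : Graph) (f : V G → V H) where

  image : VertexSet G → VertexSet H
  image C = fromList H (map f (vertices G C))

  ∣image∣≤ : ∀ C → ∣ image C ∣ ≤ ∣ C ∣
  ∣image∣≤ C = ≤-trans (∣fromList∣≤length H (map f (vertices G C)))
    (≤-reflexive (trans (length-map f (vertices G C)) (length-vertices G C)))

  ∈-image⁺ : ∀ C {u} → ⟦_⟧ G C u → ⟦_⟧ H (image C) (f u)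
  ∈-image⁺ C u∈C = ∈-fromList⁺ H (∈-map⁺ f (∈-vertices⁺ G C u∈C))

  ∈-image⁻ : ∀ C {w} → ⟦_⟧ H (image C) w → ∃ λ u → ⟦_⟧ G C u × w ≡ f u
  ∈-image⁻ C w∈ with u , u∈ , w≡fu ← ∈-map⁻ f (∈-fromList⁻ H _ w∈) =
    u , ∈-vertices⁻ G C u∈ , w≡fu

  image-isCode : ∀ C → IsCode G C → IsCode H (image C)
  image-isCode C ne with u , u∈C ← isCode⁻ G C ne = isCode⁺ H (image C) (f u , ∈-image⁺ C u∈C)

-- Invariance of codes under isomorphism.

infix 4 _≅_

-- Phrased with closed neighbourhoods instead of adjacency, since both kinds of code see the graph
-- through `N[_]` alone.
record _≅_ (G H : Graph) : Set where
  field
    bijection : V G ↔ V H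
  open Inverse bijection public using (to; from; strictlyInverseˡ; strictlyInverseʳ)
  field
    to-N[]   : ∀ {u v} → N[_] G u v → N[_] H (to u) (to v)
    from-N[] : ∀ {u v} → N[_] H u v → N[_] G (from u) (from v)

module _ {G H : Graph} (G≅H : G ≅ H) where
  open _≅_ G≅H

  private
    image-∈⁻ : ∀ C {w} → ⟦_⟧ H (image G H to C) w → ⟦_⟧ G C (from w)
    image-∈⁻ C w∈ with u , u∈C , refl ← ∈-image⁻ G H to C w∈ =
      subst (⟦_⟧ G C) (sym (strictlyInverseʳ u)) u∈C

    image-∈⁺ : ∀ C {w} → ⟦_⟧ G C (from w) → ⟦_⟧ H (image G H to C) w
    image-∈⁺ C {w} w∈ = subst (⟦_⟧ H (image G H to C)) (strictlyInverseˡ w) (∈-image⁺ G H to C w∈)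

    image-I⁺ : ∀ C {w c} → I G C (from w) c → I H (image G H to C) w (to c)
    image-I⁺ C {w} {c} (n , c∈C) =
      subst (λ x → N[_] H x (to c)) (strictlyInverseˡ w) (to-N[] n) , ∈-image⁺ G H to C c∈C

    image-I⁻ : ∀ C {w c} → I H (image G H to C) w (to c) → I G C (from w) c
    image-I⁻ C {w} {c} (n , c∈) = subst (I G C (from w)) (strictlyInverseʳ c)
      (from-N[] n , image-∈⁻ C c∈)

    from-injective : ∀ {w x} → from w ≡ from x → w ≡ x
    from-injective {w} {x} eq =
      trans (sym (strictlyInverseˡ w)) (trans (cong to eq) (strictlyInverseˡ x))

  image-self : ∀ C → SelfLocatingDominating G C → SelfLocatingDominating H (image G H to C)
  image-self C (ne , sld) = image-isCode G H to C ne , λ w w∉ →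
    let (c , c∈I) , ⋂⊆ , _ = sld (from w) (w∉ ∘ image-∈⁺ C) in
    (to c , image-I⁺ C c∈I) ,
    -- A vertex `x` in the intersection around `w` pulls back to one in the intersection around
    -- `from w`, which is `from w` itself.
    (λ {x} x∈⋂ → from-injective (⋂⊆ λ (d , d∈I) →
       subst (λ e → N[_] G e (from x)) (strictlyInverseʳ d)
         (from-N[] (x∈⋂ (to d , image-I⁺ C d∈I))))) ,
    -- A vertex always lies in the intersection taken over its own code neighbours, because closed
    -- neighbourhoods are symmetric.
    λ { refl (d , n , _) → N[]-sym H n }

  image-solid : ∀ C → SolidLocatingDominating G C → SolidLocatingDominating H (image G H to C)
  image-solid C (ne , dom , sep) =
    image-isCode G H to C ne ,
    (λ w w∉ → let c , c∈I = dom (from w) (w∉ ∘ image-∈⁺ C) in to c , image-I⁺ C c∈I) ,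
    (λ w x w∉ x∉ w≢x I⊆ →
      sep (from w) (from x) (w∉ ∘ image-∈⁺ C) (x∉ ∘ image-∈⁺ C) (w≢x ∘ from-injective)
        (λ c∈I → image-I⁻ C (I⊆ (image-I⁺ C c∈I))))

□-comm : ∀ G H → (G □ H) ≅ (H □ G)
□-comm G H = record
  { bijection = ×-comm (V G) (V H)
  ; to-N[]    = swap-N[] G H
  ; from-N[]  = swap-N[] H G
  }
  where
  swap-N[] : ∀ G H {u v} → N[_] (G □ H) u v → N[_] (H □ G) (swap u) (swap v)
  swap-N[] G H (inj₁ (inj₁ p)) = inj₁ (inj₂ (swap p))
  swap-N[] G H (inj₁ (inj₂ p)) = inj₁ (inj₁ (swap p))
  swap-N[] G H (inj₂ refl)     = inj₂ refl

-- Closed neighbourhoods in the product.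

module _ (G H : Graph) where
  private
    module H = Graph H
    GH = G □ H

  N[]-□⁺ : ∀ {u u′} v → N[_] G u u′ → N[_] GH (u , v) (u′ , v)
  N[]-□⁺ v (inj₁ u~u′) = inj₁ (inj₂ (u~u′ , refl))
  N[]-□⁺ v (inj₂ refl) = inj₂ refl

  N[]-□⁻ : ∀ {u u′ v v′} → N[_] GH (u , v) (u′ , v′) → N[_] G u u′
  N[]-□⁻ (inj₁ (inj₁ (u≡u′ , _))) = inj₂ u≡u′
  N[]-□⁻ (inj₁ (inj₂ (u~u′ , _))) = inj₁ u~u′
  N[]-□⁻ (inj₂ refl)              = inj₂ refl

  -- An edge of the product moves exactly one coordinate, so a change in the second one fixes the
  -- first.
  N[]-□-≢ : ∀ {u u′ v v′} → v ≢ v′ → N[_] GH (u , v) (u′ , v′) → u ≡ u′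
  N[]-□-≢ v≢v′ (inj₁ (inj₁ (u≡u′ , _))) = u≡u′
  N[]-□-≢ v≢v′ (inj₁ (inj₂ (_ , v≡v′))) = contradiction v≡v′ v≢v′
  N[]-□-≢ v≢v′ (inj₂ refl)              = refl

  -- Projecting codes of the product to the first factor.

  module _ (C : VertexSet GH) where
    private C₁ = image GH G proj₁ C

    -- If `(c , w)` were equal to `(u , v)` or adjacent to it along `H`, then `c ≡ u` would put `u`
    -- in the projection. Only edges along `G` remain, and these keep the second coordinate.
    I-image-proj₁⁺ : ∀ {u v c w} → u ∉ ⟦_⟧ G C₁ → I GH C (u , v) (c , w) → I G C₁ u c × v ≡ w
    I-image-proj₁⁺ u∉ (n , c∈C) with ∈-image⁺ GH G proj₁ C c∈C | n
    ... | c∈ | inj₁ (inj₁ (refl , _))   = contradiction c∈ u∉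
    ... | c∈ | inj₁ (inj₂ (u~c , v≡w)) = (inj₁ u~c , c∈) , v≡w
    ... | c∈ | inj₂ refl                = contradiction c∈ u∉

    image-proj₁-self : SelfLocatingDominating GH C → SelfLocatingDominating G C₁
    image-proj₁-self (ne , sld) = image-isCode GH G proj₁ C ne , λ u u∉ →
      let v = aVertex H
          ((c , w) , c∈I) , ⋂⊆ , _ = sld (u , v) (u∉ ∘ ∈-image⁺ GH G proj₁ C)
      in (c , proj₁ (I-image-proj₁⁺ u∉ c∈I)) ,
         -- To locate `x` in `G`, locate `(x , v)` in the product: every code vertex seen from
         -- `(u , v)` has second coordinate `v`, so its closed neighbourhood contains `(x , v)` once
         -- that of its projection contains `x`.
         (λ {x} x∈⋂ → cong proj₁ (⋂⊆ {x , v} λ ((d , y) , d∈I) →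
            let d∈I₁ , v≡y = I-image-proj₁⁺ u∉ d∈I in
            subst (λ z → N[_] GH (d , z) (x , v)) v≡y (N[]-□⁺ v (x∈⋂ (d , d∈I₁))))) ,
         λ { refl (d , n , _) → N[]-sym G n }

    image-proj₁-solid : SolidLocatingDominating GH C → SolidLocatingDominating G C₁
    image-proj₁-solid (ne , dom , sep) =
      image-isCode GH G proj₁ C ne ,
      (λ u u∉ →
        let (c , _) , c∈I = dom (u , v) (u∉ ∘ ∈-image⁺ GH G proj₁ C)
        in c , proj₁ (I-image-proj₁⁺ u∉ c∈I)) ,
      (λ u x u∉ x∉ u≢x I⊆ →
        sep (u , v) (x , v) (u∉ ∘ ∈-image⁺ GH G proj₁ C) (x∉ ∘ ∈-image⁺ GH G proj₁ C)
          (u≢x ∘ cong proj₁)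
          -- `I⊆` contributes the neighbourhood relation between `x` and `c`. Membership in `C` is
          -- carried over from `c∈I`, as `c` lying in the projection does not say which vertex of
          -- its fibre is in `C`.
          λ {(c , w)} c∈I@(_ , c∈C) →
            let c∈I₁ , v≡w = I-image-proj₁⁺ u∉ c∈I in
            subst (λ z → N[_] GH (x , v) (c , z)) v≡w (N[]-□⁺ v (proj₁ (I⊆ c∈I₁))) , c∈C)
      where v = aVertex H

  -- Lifting codes of the first factor to the product.

  module _ (C : VertexSet G) where

    _×V : VertexSet GH
    _×V = fromList GH (cartesianProduct (vertices G C) (vertices H Subset.⊤))

    ∣×V∣≤ : ∣ _×V ∣ ≤ order H * ∣ C ∣
    ∣×V∣≤ = begin
      ∣ _×V ∣
      ≤⟨ ∣fromList∣≤length GH (cartesianProduct (vertices G C) (vertices H Subset.⊤)) ⟩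
      length (cartesianProduct (vertices G C) (vertices H Subset.⊤))
        ≡⟨ length-cartesianProduct (vertices G C) (vertices H Subset.⊤) ⟩
      length (vertices G C) * length (vertices H Subset.⊤)
        ≡⟨ cong₂ _*_ (length-vertices G C) (trans (length-vertices H Subset.⊤) (Subset.∣⊤∣≡n _)) ⟩
      ∣ C ∣ * order H                                          ≡⟨ *-comm ∣ C ∣ (order H) ⟩
      order H * ∣ C ∣                                          ∎
      where open ≤-Reasoning

    ∈-×V⁺ : ∀ {u v} → ⟦_⟧ G C u → ⟦_⟧ GH _×V (u , v)
    ∈-×V⁺ u∈C = ∈-fromList⁺ GH
      (∈-cartesianProduct⁺ (∈-vertices⁺ G C u∈C) (∈-vertices⁺ H Subset.⊤ Subset.∈⊤))

    ∈-×V⁻ : ∀ {u v} → ⟦_⟧ GH _×V (u , v) → ⟦_⟧ G C u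
    ∈-×V⁻ uv∈ = ∈-vertices⁻ G C
      (proj₁ (∈-cartesianProduct⁻ (vertices G C) (vertices H Subset.⊤) (∈-fromList⁻ GH _ uv∈)))

    I-×V⁺ : ∀ {u c} v → I G C u c → I GH _×V (u , v) (c , v)
    I-×V⁺ v (n , c∈C) = N[]-□⁺ v n , ∈-×V⁺ c∈C

    I-×V⁻ : ∀ {u c v w} → I GH _×V (u , v) (c , w) → I G C u c
    I-×V⁻ (n , c∈) = N[]-□⁻ n , ∈-×V⁻ c∈

    ×V-isCode : IsCode G C → IsCode GH _×V
    ×V-isCode ne with u , u∈C ← isCode⁻ G C ne =
      isCode⁺ GH _×V ((u , aVertex H) , ∈-×V⁺ u∈C)

    ×V-self : SelfLocatingDominating G C → SelfLocatingDominating GH _×V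
    ×V-self (ne , sld) = ×V-isCode ne , λ (u , v) uv∉ →
      let u∉ = uv∉ ∘ ∈-×V⁺
          (c , c∈I) , ⋂⊆ , _ = sld u u∉

          locate : ∀ {w x} → (∀ d → I GH _×V (u , v) d → N[_] GH d (w , x)) →
                   (u , v) ≡ (w , x)
          locate {w} {x} x∈⋂ =
            let u≡w = ⋂⊆ λ (d , d∈I) → N[]-□⁻ (x∈⋂ (d , v) (I-×V⁺ v d∈I))
                -- In a different copy, `(w , x)` can be near `(c , v)` only if `c ≡ w`. As `w` is
                -- already known to be `u`, this would put `u` in `C`.
                v≡x = decidable-stable (v H.≟ⱽ x) λ v≢x →
                  u∉ (subst (⟦_⟧ G C)
                       (trans (N[]-□-≢ v≢x (x∈⋂ (c , v) (I-×V⁺ v c∈I))) (sym u≡w))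
                       (proj₂ c∈I))
            in cong₂ _,_ u≡w v≡x
      in ((c , v) , I-×V⁺ v c∈I) ,
         (λ x∈⋂ → locate λ d d∈I → x∈⋂ (d , d∈I)) ,
         λ { refl (d , n , _) → N[]-sym GH n }

    ×V-solid : SolidLocatingDominating G C → SolidLocatingDominating GH _×V
    ×V-solid (ne , dom , sep) =
      ×V-isCode ne ,
      (λ (u , v) uv∉ → let c , c∈I = dom u (uv∉ ∘ ∈-×V⁺) in (c , v) , I-×V⁺ v c∈I) ,
      separate
      where
      separate : ∀ p q → p ∉ ⟦_⟧ GH _×V → q ∉ ⟦_⟧ GH _×V → p ≢ q →
                 ¬ (I GH _×V p ⊆ I GH _×V q)
      separate (u , v) (w , x) p∉ q∉ p≢q I⊆ with v H.≟ⱽ x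
      ... | yes refl = sep u w (p∉ ∘ ∈-×V⁺) (q∉ ∘ ∈-×V⁺) (p≢q ∘ cong (_, v))
                         λ c∈I → I-×V⁻ (I⊆ (I-×V⁺ v c∈I))
      -- Domination of `u` settles different copies: the code vertex `(c , v)` seen from `(u , v)`
      -- is also seen from `(w , x)`, so `c ≡ w`, and `(w , x)` would be in the code.
      ... | no v≢x =
        let c , c∈I = dom u (p∉ ∘ ∈-×V⁺)
            n , c∈  = I⊆ (I-×V⁺ v c∈I)
        in q∉ (∈-×V⁺ (subst (⟦_⟧ G C) (sym (N[]-□-≢ (v≢x ∘ sym) n)) (proj₂ c∈I)))

-- From constructions on codes to bounds on minimum sizes.

-- Apply `F` to a code attaining `k`; the result competes for the minimum `l`. The function `f` is
-- the identity for projections and isomorphisms, and multiplication by the order of `H` for lifts.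
minimum-transfer : ∀ G H P Q {k l} (f : ℕ → ℕ) →
  IsMinimumSize G P k → IsMinimumSize H Q l →
  (F : VertexSet G → VertexSet H) →
  (∀ C → P C → Q (F C)) → (∀ C → ∣ F C ∣ ≤ f ∣ C ∣) → l ≤ f k
minimum-transfer _ _ _ _ f ((C , p , refl) , _) (_ , l≤) F pres size =
  ≤-trans (l≤ (F C) (pres C p)) (size C)

-- Self- and solid-location share these three closure properties, so one argument yields both parts
-- of the theorem.
module _ (𝒫 : ∀ G → Pred (VertexSet G) 0ℓ) (γ : Graph → ℕ)
         (γ-min : ∀ G → IsMinimumSize G (𝒫 G) (γ G))
         (𝒫-image : ∀ {G H} (e : G ≅ H) C → 𝒫 G C → 𝒫 H (image G H (_≅_.to e) C))
         (𝒫-proj₁ : ∀ G H C → 𝒫 (G □ H) C → 𝒫 G (image (G □ H) G proj₁ C))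
         (𝒫-×V : ∀ G H C → 𝒫 G C → 𝒫 (G □ H) (_×V G H C))
  where

  -- Transfers the bounds proved for the first factor to the second. With `G` and `H` exchanged it
  -- also gives the reverse inequality.
  □-comm-≤ : ∀ G H → γ (G □ H) ≤ γ (H □ G)
  □-comm-≤ G H = minimum-transfer (H □ G) (G □ H) (𝒫 (H □ G)) (𝒫 (G □ H))
    id (γ-min (H □ G)) (γ-min (G □ H)) (image (H □ G) (G □ H) swap)
    (𝒫-image (□-comm H G)) (∣image∣≤ (H □ G) (G □ H) swap)

  factor-≤ : ∀ G H → γ G ≤ γ (G □ H)
  factor-≤ G H = minimum-transfer (G □ H) G (𝒫 (G □ H)) (𝒫 G)
    id (γ-min (G □ H)) (γ-min G) (image (G □ H) G proj₁)
    (𝒫-proj₁ G H) (∣image∣≤ (G □ H) G proj₁)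

  □-≤ : ∀ G H → γ (G □ H) ≤ order H * γ G
  □-≤ G H = minimum-transfer G (G □ H) (𝒫 G) (𝒫 (G □ H))
    (order H *_) (γ-min G) (γ-min (G □ H)) (_×V G H)
    (𝒫-×V G H) (∣×V∣≤ G H)

  □-bounds : ∀ G H → γ G ⊔ γ H ≤ γ (G □ H) ×
                     γ (G □ H) ≤ (order H * γ G) ⊓ (order G * γ H)
  □-bounds G H =
    ⊔-lub (factor-≤ G H) (≤-trans (factor-≤ H G) (□-comm-≤ H G)) ,
    ⊓-glb (□-≤ G H) (≤-trans (□-comm-≤ G H) (□-≤ H G))

mainTheorem14 : (G H : Graph) →
    (γˢˡᵈ G ⊔ γˢˡᵈ H ≤ γˢˡᵈ (G □ H) ×
    γˢˡᵈ (G □ H) ≤ (Graph.order H * γˢˡᵈ G) ⊓ (Graph.order G * γˢˡᵈ H)) ×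
    (γᵈˡᵈ G ⊔ γᵈˡᵈ H ≤ γᵈˡᵈ (G □ H) ×
    γᵈˡᵈ (G □ H) ≤ (Graph.order H * γᵈˡᵈ G) ⊓ (Graph.order G * γᵈˡᵈ H))
mainTheorem14 G H =
  □-bounds SelfLocatingDominating γˢˡᵈ γˢˡᵈ-isMinimum
    image-self image-proj₁-self ×V-self G H ,
  □-bounds SolidLocatingDominating γᵈˡᵈ γᵈˡᵈ-isMinimum
    image-solid image-proj₁-solid ×V-solid G H
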